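{- Let $m,n\ge 1$ and let $R=(r_1,\dots,r_m)$ and $S=(s_1,\dots,s_n)$ be vectors of nonnegative integers with $r_i\le n$ for all $i$, $s_j\le m$ for all $j$, and $\sum_i r_i=\sum_j s_j$. Then $\mathcal{A}^{\infty}(R,S)\neq\emptyset$ if and only if all of the following hold: (a) $S$ is palindromic, i.e. $s_j=s_{n+1-j}$ for all $j$; (b) if $n$ is even then every component of $R$ is even, and if $n$ is odd then $s_{\lceil n/2\rceil}\ge o(R)$, where $o(R)$ is the number of odd components of $R$; (c) $\overline{S}\preceq \overline{R}^*$, where $\overline{R}$ is obtained from $R$ by subtracting one from every odd component, and $\overline{S}$ is $S$ if $n$ is even, or $S$ with the component $s_{\lceil n/2\rceil}$ removed if $n$ is odd.
   Context: $\mathcal{A}^{\infty}(R,S)$ is the set of $m\times n$ matrices $A$ with entries in $\{0,1\}$, with $i$th row sum $r_i$ and $j$th column sum $s_j$ for all $i,j$, that are invariant under the reflection $r_\infty$ in a vertical line, i.e. $a_{i,j}=a_{i,\,n+1-j}$ for all $i,j$. For a nonnegative integer vector $R$, $R^*$ denotes the conjugate of (the weakly decreasing rearrangement of) $R$ viewed as an integer partition: its $k$th component is the number of $i$ with $r_i\ge k$. For nonnegative integer vectors $U,V$, $V\preceq U$ ($V$ is majorized by $U$) means that, after rearranging both in weakly decreasing order (and padding with zeros to a common length), $u_1+\dots+u_\ell\ge v_1+\dots+v_\ell$ for all $\ell$, and the total sums of $U$ and $V$ are equal. -}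

module Defs where

import Algebra.Properties.CommutativeMonoid.Sum
open import Data.Bool.Base using (if_then_else_)
open import Data.Fin.Base using (Fin; toℕ; fromℕ<; opposite)
open import Data.List.Base using (List; length; filter; map; take; applyUpTo)
open import Data.List.Extrema.Nat using (max)
import Data.List.Sort
open import Data.Nat.Base using (ℕ; suc; pred; _≤_; _≥_; s≤s; ⌊_/2⌋; NonZero)
open import Data.Nat.Divisibility using (_∣_; _∣?_)
import Data.Nat.ListAction as List
open import Data.Nat.Properties using (_≤?_; ⌊n/2⌋≤n; ≤-decTotalOrder; +-0-commutativeMonoid)
open import Data.Product.Base using (_×_)
open import Data.Vec.Functional using (Vector; toList; removeAt)
open import Relation.Binary.Construct.Flip.EqAndOrd using (decTotalOrder)
open import Relation.Binary.PropositionalEquality.Core using (_≡_)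
open import Relation.Nullary.Decidable.Core using (does; ¬?)
open import Relation.Nullary.Negation.Core using (¬_)

open Algebra.Properties.CommutativeMonoid.Sum +-0-commutativeMonoid public using (sum)

-- The flipped order makes `sort` arrange lists in weakly decreasing order.
open Data.List.Sort (decTotalOrder ≤-decTotalOrder) public using (sort; sort-↭; sort-↗)

-- `opposite j` on 0-based indices is j ↦ n + 1 - j on 1-based ones.

Matrix01 : ℕ → ℕ → Set
Matrix01 m n = Fin m → Fin n → Fin 2

record 𝒜∞ {m n : ℕ} (R : Vector ℕ m) (S : Vector ℕ n) (A : Matrix01 m n) : Set where
  field
    rowSums   : ∀ i → sum (λ j → toℕ (A i j)) ≡ R i
    colSums   : ∀ j → sum (λ i → toℕ (A i j)) ≡ S j
    invariant : ∀ i j → A i j ≡ A i (opposite j)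

Palindromic : ∀ {n} → Vector ℕ n → Set
Palindromic S = ∀ j → S j ≡ S (opposite j)

-- The ⌈n/2⌉-th index in 1-based counting: ⌈(k+1)/2⌉ - 1 = ⌊k/2⌋.
middle : ∀ n → .{{NonZero n}} → Fin n
middle (suc k) = fromℕ< (s≤s (⌊n/2⌋≤n k))

countOdd : ∀ {m} → Vector ℕ m → ℕ
countOdd R = length (filter (λ r → ¬? (2 ∣? r)) (toList R))

-- Parts beyond the largest entry are zero and are omitted.
conjugate : List ℕ → List ℕ
conjugate xs = applyUpTo (λ k → length (filter (suc k ≤?_) xs)) (max 0 xs)

-- `take ℓ` past the end of a list is the same as padding with zeros.
infix 4 _⪯_
_⪯_ : List ℕ → List ℕ → Set
V ⪯ U = (∀ ℓ → List.sum (take ℓ (sort U)) ≥ List.sum (take ℓ (sort V)))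
      × List.sum U ≡ List.sum V

roundDownEven : ∀ {m} → Vector ℕ m → List ℕ
roundDownEven R = map (λ r → if does (2 ∣? r) then r else pred r) (toList R)

dropMiddleIfOdd : ∀ {n} → .{{NonZero n}} → Vector ℕ n → List ℕ
dropMiddleIfOdd {suc k} S =
  if does (2 ∣? suc k) then toList S else toList (removeAt S (middle (suc k)))

ParityCondition : ∀ {m n} → .{{NonZero n}} → Vector ℕ m → Vector ℕ n → Set
ParityCondition {n = n} R S =
    (2 ∣ n → ∀ i → 2 ∣ R i)
  × (¬ 2 ∣ n → S (middle n) ≥ countOdd R)

{-# OPTIONS --safe #-}

-- In a matrix with symmetric rows only the middle column can make a row sum
-- odd, so the middle column is forced to be the parity vector of R, and the
-- remaining columns come in equal pairs. This leaves a Gale–Ryser problem for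
-- the left half of the columns with the halved row sums, and doubling every
-- part turns its majorization condition into the one for the full matrix.
-- Gale–Ryser itself is proved greedily: place each column in the rows with the
-- largest remaining sums.

module Submission where

open import Defs
import Algebra.Properties.CommutativeMonoid.Sum
import Algebra.Properties.CommutativeSemigroup
open import Data.Bool.Base using (if_then_else_)
open import Data.Fin.Base using (Fin; zero; suc; toℕ; fromℕ; fromℕ<; inject₁; opposite)
open import Data.Fin.Patterns using (0F; 1F)
open import Data.Fin.Properties using (toℕ-injective; toℕ-fromℕ<; toℕ-inject₁; opposite-involutive)
open import Data.Fin.Relation.Unary.Top using (view; ‵fromℕ; ‵inject₁)
open import Data.List.Base using (List; []; _∷_; [_]; _++_; map; length; filter; take; applyUpTo)
open import Data.List.Extrema.Nat using (max; xs≤max)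
open import Data.List.Properties
  using (map-tabulate; tabulate-cong; take-map; map-applyUpTo; length-take; length-map; length-++)
open import Data.List.Relation.Binary.Permutation.Propositional
  using (_↭_; ↭-refl; ↭-sym; ↭-trans; prep; swap; module PermutationReasoning)
open import Data.List.Relation.Binary.Permutation.Propositional.Properties
  using (map⁺; ↭-map-inv; shift; drop-∷; ++⁺ˡ; ∷↭∷ʳ)
open import Data.List.Relation.Binary.Sublist.Propositional using (_⊆_; []; _∷_; _∷ʳ_; minimum)
open import Data.List.Relation.Binary.Sublist.Propositional.Properties using (take-⊆; ++⁺)
open import Data.List.Relation.Unary.All as All using (All; []; _∷_)
open import Data.List.Relation.Unary.All.Properties using (tabulate⁻)
open import Data.List.Relation.Unary.AllPairs using (AllPairs; []; _∷_)
open import Data.List.Relation.Unary.Linked.Properties using (Linked⇒AllPairs)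
open import Data.Nat.Base
  using (ℕ; zero; suc; pred; _+_; _*_; _∸_; _⊓_; _≤_; _<_; _≥_; NonZero; ⌊_/2⌋; z≤n; s≤s; s≤s⁻¹)
open import Data.Nat.Divisibility
  using (_∣_; _∣?_; divides; ∣-refl; ∣m+n∣m⇒∣n; ∣m∣n⇒∣m+n; ∣1⇒≡1)
import Data.Nat.ListAction as List
open import Data.Nat.ListAction.Properties using (sum-↭; sum-++)
open import Data.Nat.Properties
open import Data.Product.Base using (∃; _×_; _,_; proj₁; proj₂)
open import Data.Sum.Base using (_⊎_; inj₁; inj₂; map₂)
open import Data.Vec.Functional as V using (Vector; toList; removeAt)
open import Function.Base using (_∘_; flip)
open import Function.Bundles using (_⇔_; mk⇔)
open import Relation.Binary.PropositionalEquality
  using (_≡_; _≗_; refl; sym; trans; cong; cong₂; subst; module ≡-Reasoning)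
open import Relation.Nullary.Decidable
  using (Dec; does; yes; no; ¬?; dec-true; dec-false; decidable-stable)
open import Relation.Nullary.Negation.Core using (¬_; contradiction)
open import Relation.Unary using (Pred; Decidable; Satisfiable)

open Algebra.Properties.CommutativeMonoid.Sum +-0-commutativeMonoid
  using (sum-cong-≗; ∑-distrib-+; sum-replicate-zero)
open Algebra.Properties.CommutativeSemigroup +-commutativeSemigroup using (interchange)

private
  variable
    m n : ℕ
    X Y : Set

-- Double counting and the Gale–Ryser theorem

sum-mono-≤ : ∀ {m} {f g : Vector ℕ m} → (∀ i → f i ≤ g i) → sum f ≤ sum g
sum-mono-≤ {zero}  f≤g = z≤n
sum-mono-≤ {suc m} f≤g = +-mono-≤ (f≤g zero) (sum-mono-≤ (f≤g ∘ suc))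

lookup≤sum : ∀ {m} (f : Vector ℕ m) i → f i ≤ sum f
lookup≤sum f zero    = m≤m+n _ _
lookup≤sum f (suc i) = ≤-trans (lookup≤sum (f ∘ suc) i) (m≤n+m _ _)

bit : ∀ {p} {P : Set p} → Dec P → Fin 2
bit P? = if does P? then 1F else 0F

bit-no : ∀ {p} {P : Set p} (P? : Dec P) → ¬ P → bit P? ≡ 0F
bit-no (yes p) ¬p = contradiction p ¬p
bit-no (no _)  _  = refl

bit-yes : ∀ {p} {P : Set p} (P? : Dec P) → P → bit P? ≡ 1F
bit-yes (yes _) _ = refl
bit-yes (no ¬p) p = contradiction p ¬p

bit≡0⇒¬ : ∀ {p} {P : Set p} (P? : Dec P) → bit P? ≡ 0F → ¬ P
bit≡0⇒¬ (no ¬p) _ = ¬p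

Column : ℕ → Set
Column m = Vector (Fin 2) m

colSum : Column m → ℕ
colSum C = sum (toℕ ∘ C)

rowSum : List (Column m) → Vector ℕ m
rowSum Cs i = List.sum (map (λ C → toℕ (C i)) Cs)

double-count : (Cs : List (Column m)) → List.sum (map colSum Cs) ≡ sum (rowSum Cs)
double-count {m} []       = sym (sum-replicate-zero m)
double-count     (C ∷ Cs) =
  trans (cong (colSum C +_) (double-count Cs)) (sym (∑-distrib-+ (toℕ ∘ C) (rowSum Cs)))

bit-mono : ∀ {p q} {P : Set p} {Q : Set q} (P? : Dec P) (Q? : Dec Q) →
  (P → Q) → toℕ (bit P?) ≤ toℕ (bit Q?)
bit-mono (no _)  _       _   = z≤n
bit-mono (yes _) (yes _) _   = s≤s z≤n
bit-mono (yes p) (no ¬q) P⇒Q = contradiction (P⇒Q p) ¬q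

-- Nested sets of rows admit a set of every size in between. The scan is greedy: a row outside `P`
-- is skipped as long as the later rows of `Q` can still supply `c`.
interpolate : ∀ {m p q} {P : Pred (Fin m) p} {Q : Pred (Fin m) q}
  (P? : Decidable P) (Q? : Decidable Q) → (∀ {i} → P i → Q i) →
  ∀ {c} → colSum (bit ∘ P?) ≤ c → c ≤ colSum (bit ∘ Q?) →
  ∃ λ (x : Column m) → colSum x ≡ c × ∀ i → (x i ≡ 1F × Q i) ⊎ (x i ≡ 0F × ¬ P i)
interpolate {zero} P? Q? P⇒Q lo hi = V.[] , sym (n≤0⇒n≡0 hi) , λ ()
interpolate {suc m} P? Q? P⇒Q {c} lo hi with P? zero | Q? zero | c ≤? colSum (bit ∘ Q? ∘ suc)
interpolate {suc m} P? Q? P⇒Q {c} lo hi | no ¬p | _ | yes hi′ =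
  let x , eq , ok = interpolate (P? ∘ suc) (Q? ∘ suc) P⇒Q lo hi′
  in 0F V.∷ x , eq , λ { zero → inj₂ (refl , ¬p) ; (suc i) → ok i }
interpolate {suc m} P? Q? P⇒Q {c} lo hi | no _ | no _ | no c≰ = contradiction hi c≰
interpolate {suc m} P? Q? P⇒Q {zero} lo hi | no _ | yes _ | no c≰ = contradiction z≤n c≰
interpolate {suc m} P? Q? P⇒Q {suc c} lo hi | no _ | yes q | no c≰ =
  -- Here the later rows of `Q` number at most `c`, and those of `P` are among them, so the lower
  -- bound survives taking this row.
  let lo′ = ≤-trans (sum-mono-≤ λ i → bit-mono (P? (suc i)) (Q? (suc i)) P⇒Q) (s≤s⁻¹ (≰⇒> c≰))
      x , eq , ok = interpolate (P? ∘ suc) (Q? ∘ suc) P⇒Q lo′ (s≤s⁻¹ hi)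
  in 1F V.∷ x , cong suc eq , λ { zero → inj₁ (refl , q) ; (suc i) → ok i }
interpolate {suc m} P? Q? P⇒Q {suc c} lo hi | yes _ | yes q | _ =
  let x , eq , ok = interpolate (P? ∘ suc) (Q? ∘ suc) P⇒Q (s≤s⁻¹ lo) (s≤s⁻¹ hi)
  in 1F V.∷ x , cong suc eq , λ { zero → inj₁ (refl , q) ; (suc i) → ok i }
interpolate {suc m} P? Q? P⇒Q {c} lo hi | yes p | no ¬q | _ = contradiction (P⇒Q p) ¬q

-- A discrete intermediate value theorem that does not ask `f` to be monotone: descend from `k`
-- until the value exceeds `c`, or until `f 0`.
crossing : (f : ℕ → ℕ) {c : ℕ} → c ≤ f 0 → ∀ k → f (suc k) ≤ c →
  ∃ λ p → f (suc p) ≤ c × c ≤ f p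
crossing f c≤f0 zero    f≤c = 0 , f≤c , c≤f0
crossing f {c} c≤f0 (suc k) f≤c with f (suc k) ≤? c
... | yes f≤c′ = crossing f c≤f0 k f≤c′
... | no  f≰c  = suc k , f≤c , <⇒≤ (≰⇒> f≰c)

-- Ties among the rows of value p may be broken arbitrarily.
LargestRows : ℕ → Vector ℕ m → Column m → Set
LargestRows p r x = ∀ i → (x i ≡ 1F × p ≤ r i) ⊎ (x i ≡ 0F × r i ≤ p)

-- The threshold is where the number of rows reaching it passes `c`: all rows above it are taken,
-- and rows equal to it fill up the count. It is positive because at least `c` rows are nonzero, so
-- every chosen row can lose a one.
largest-rows : (r : Vector ℕ m) {c : ℕ} → c ≤ sum (λ i → r i ⊓ 1) →
  ∃ λ p → ∃ λ x → colSum x ≡ c × LargestRows (suc p) r x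
largest-rows {m} r {c} c≤ =
  -- No row exceeds `sum r`, so the count has dropped to zero there.
  let p , lo , hi = crossing count c≤count (sum r) (≤-trans (≤-reflexive count-sum) z≤n)
      x , eq , ok = interpolate (λ i → suc (suc p) ≤? r i) (λ i → suc p ≤? r i) <⇒≤ lo hi
  in p , x , eq , λ i → map₂ (λ (x≡0 , r≯) → x≡0 , s≤s⁻¹ (≰⇒> r≯)) (ok i)
  where
  count : ℕ → ℕ
  count k = colSum (λ i → bit (suc k ≤? r i))
  ⊓1≤bit : ∀ n → n ⊓ 1 ≤ toℕ (bit (1 ≤? n))
  ⊓1≤bit zero    = z≤n
  ⊓1≤bit (suc n) = s≤s (≤-reflexive (⊓-zeroʳ n))
  c≤count : c ≤ count 0
  c≤count = ≤-trans c≤ (sum-mono-≤ (⊓1≤bit ∘ r))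
  count-sum : count (suc (sum r)) ≡ 0
  count-sum = trans
    (sum-cong-≗ {m} λ i → cong toℕ (bit-no (_ ≤? _) (<⇒≱ (s≤s (m≤n⇒m≤1+n (lookup≤sum r i))))))
    (sum-replicate-zero m)

-- The Gale–Ryser condition. Quantifying over all sublists, not only over the
-- prefixes of a sorted list, makes it stable under removing an arbitrary column.
Dominated : Vector ℕ m → List ℕ → Set
Dominated r cs = ∀ {ds} → ds ⊆ cs → List.sum ds ≤ sum (λ i → r i ⊓ length ds)

module _ {r : Vector ℕ m} {p : ℕ} {x : Column m} (largest : LargestRows (suc p) r x) where

  remainder : Vector ℕ m
  remainder i = r i ∸ toℕ (x i)

  remainder-+ : ∀ i → toℕ (x i) + remainder i ≡ r i
  remainder-+ i with x i | largest i
  ... | _ | inj₁ (refl , p<r) = m+[n∸m]≡n (≤-trans (s≤s z≤n) p<r)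
  ... | _ | inj₂ (refl , _)   = refl

  -- A chosen row exceeds `p`, so it still has `ℓ` left after losing a one, and truncation at `ℓ`
  -- does not see the loss.
  ⊓-short : ∀ {ℓ} → ℓ ≤ p → ∀ i → r i ⊓ ℓ ≤ remainder i ⊓ ℓ
  ⊓-short {ℓ} ℓ≤p i with x i | r i | largest i
  ... | _ | suc n | inj₁ (refl , s≤s p≤n) =
    ⊓-glb (≤-trans (m⊓n≤n (suc n) ℓ) (≤-trans ℓ≤p p≤n)) (m⊓n≤n (suc n) ℓ)
  ... | _ | n     | inj₂ (refl , _)       = ≤-refl

  -- Raising the cap from `ℓ` to `suc ℓ` gains at most the one placed in a chosen row, and gains
  -- nothing in the others, which are at most `suc p` and hence at most `ℓ`.
  ⊓-long : ∀ {ℓ} → p < ℓ → ∀ i → r i ⊓ suc ℓ ≤ toℕ (x i) + remainder i ⊓ ℓ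
  ⊓-long {ℓ} p<ℓ i with x i | r i | largest i
  ... | _ | suc n | inj₁ (refl , _)   = ≤-refl
  ... | _ | n     | inj₂ (refl , n≤p) =
    ⊓-glb (m⊓n≤m n (suc ℓ)) (≤-trans (m⊓n≤m n (suc ℓ)) (≤-trans n≤p p<ℓ))

  -- The invariant of the greedy step. Up to `p` columns, the old bound for `ds` alone suffices;
  -- beyond that, the old bound for `ds` together with the placed column does, after cancelling that
  -- column.
  remainder-dominated : ∀ {cs} → Dominated r (colSum x ∷ cs) → Dominated remainder cs
  remainder-dominated dom {ds} ds⊆cs with length ds ≤? p
  ... | yes ℓ≤p = ≤-trans (dom (_ ∷ʳ ds⊆cs)) (sum-mono-≤ (⊓-short ℓ≤p))
  ... | no  ℓ≰p = +-cancelˡ-≤ (colSum x) _ _ (begin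
    colSum x + List.sum ds                               ≤⟨ dom (refl ∷ ds⊆cs) ⟩
    sum (λ i → r i ⊓ suc (length ds))                    ≤⟨ sum-mono-≤ (⊓-long (≰⇒> ℓ≰p)) ⟩
    sum (λ i → toℕ (x i) + remainder i ⊓ length ds)      ≡⟨ ∑-distrib-+ (toℕ ∘ x) _ ⟩
    colSum x + sum (λ i → remainder i ⊓ length ds)       ∎)
    where open ≤-Reasoning

sum≡0⇒lookup≡0 : (f : Vector ℕ m) → sum f ≡ 0 → ∀ i → f i ≡ 0
sum≡0⇒lookup≡0 f eq i = n≤0⇒n≡0 (subst (f i ≤_) eq (lookup≤sum f i))

gale-ryser : ∀ cs (r : Vector ℕ m) → Dominated r cs → List.sum cs ≡ sum r →
  ∃ λ Cs → map colSum Cs ≡ cs × ∀ i → rowSum Cs i ≡ r i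
gale-ryser []       r dom eq = [] , refl , λ i → sym (sum≡0⇒lookup≡0 r (sym eq) i)
gale-ryser (c ∷ cs) r dom eq
  with p , x , refl , largest ← largest-rows r
         -- Domination of the one-column sublist: `c` is at most the number of nonzero rows.
         (subst (_≤ _) (+-identityʳ c) (dom (refl ∷ minimum cs))) =
  let r′ = remainder largest
      Cs , cols , rows = gale-ryser cs r′ (remainder-dominated largest dom)
        (+-cancelˡ-≡ (colSum x) _ _ (begin
          colSum x + List.sum cs ≡⟨ eq ⟩
          sum r                  ≡⟨ sum-cong-≗ (remainder-+ largest) ⟨
          sum (λ i → toℕ (x i) + r′ i) ≡⟨ ∑-distrib-+ (toℕ ∘ x) r′ ⟩
          colSum x + sum r′      ∎))
  in x ∷ Cs , cong (colSum x ∷_) cols ,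
     λ i → trans (cong (toℕ (x i) +_) (rows i)) (remainder-+ largest i)
  where open ≡-Reasoning

-- Sums of largest parts and conjugates

sum-⊆ : ∀ (f : ℕ → ℕ) {xs ys} → xs ⊆ ys → List.sum (map f xs) ≤ List.sum (map f ys)
sum-⊆ f []             = z≤n
sum-⊆ f (y ∷ʳ xs⊆ys)   = ≤-trans (sum-⊆ f xs⊆ys) (m≤n+m _ (f y))
sum-⊆ f (refl ∷ xs⊆ys) = +-monoʳ-≤ (f _) (sum-⊆ f xs⊆ys)

-- A threshold θ certifies that the ℓ largest entries have maximal sum: every
-- choice of ℓ entries is bounded by ℓ θ + Σ (x ∸ θ), and they attain the bound.
sum≤threshold : ∀ θ xs → List.sum xs ≤ length xs * θ + List.sum (map (_∸ θ) xs)
sum≤threshold θ []       = z≤n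
sum≤threshold θ (x ∷ xs) = begin
  x + List.sum xs
    ≤⟨ +-mono-≤ (m≤n+m∸n x θ) (sum≤threshold θ xs) ⟩
  (θ + (x ∸ θ)) + (length xs * θ + List.sum (map (_∸ θ) xs))
    ≡⟨ interchange θ (x ∸ θ) _ _ ⟩
  (θ + length xs * θ) + ((x ∸ θ) + List.sum (map (_∸ θ) xs)) ∎
  where open ≤-Reasoning

sum-∸≡0 : ∀ {θ xs} → All (_≤ θ) xs → List.sum (map (_∸ θ) xs) ≡ 0
sum-∸≡0 []           = refl
sum-∸≡0 (x≤θ ∷ xs≤θ) = cong₂ _+_ (m≤n⇒m∸n≡0 x≤θ) (sum-∸≡0 xs≤θ)

-- The threshold is the entry right after the first `ℓ`, or zero if there is none. The last
-- component serves the induction: it puts `θ` below the head, so that `θ + (x ∸ θ)` is `x`.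
threshold≤sum-take : ∀ ℓ {xs} → AllPairs _≥_ xs →
  ∃ λ θ → ℓ * θ + List.sum (map (_∸ θ) xs) ≤ List.sum (take ℓ xs)
        × (∀ {b} → All (_≤ b) xs → θ ≤ b)
threshold≤sum-take zero    []                 = 0 , z≤n , λ _ → z≤n
threshold≤sum-take (suc ℓ) []                 =
  0 , ≤-reflexive (trans (+-identityʳ _) (*-zeroʳ ℓ)) , λ _ → z≤n
threshold≤sum-take zero    {x ∷ xs} (≥xs ∷ _) =
  x , ≤-reflexive (sum-∸≡0 (≤-refl ∷ ≥xs)) , All.head
threshold≤sum-take (suc ℓ) {x ∷ xs} (≥xs ∷ ↗xs)
  with θ , bound , least ← threshold≤sum-take ℓ ↗xs = θ , (begin
    (θ + ℓ * θ) + ((x ∸ θ) + List.sum (map (_∸ θ) xs))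
      ≡⟨ interchange θ (ℓ * θ) (x ∸ θ) _ ⟩
    (θ + (x ∸ θ)) + (ℓ * θ + List.sum (map (_∸ θ) xs))
      ≤⟨ +-mono-≤ (≤-reflexive (m+[n∸m]≡n (least ≥xs))) bound ⟩
    x + List.sum (take ℓ xs) ∎) , least ∘ All.tail
  where open ≤-Reasoning

-- With the threshold of the sorted list, the bound grows with the length and with the total excess
-- over `θ`. The excess is monotone in sublists and blind to order, so positions never have to be
-- compared.
sum≤sum-take-sort : ∀ {ys xs zs} ℓ → ys ⊆ xs → xs ↭ zs → length ys ≤ ℓ →
  List.sum ys ≤ List.sum (take ℓ (sort zs))
sum≤sum-take-sort {ys} {xs} {zs} ℓ ys⊆xs xs↭zs ys≤ℓ
  with θ , bound , _ ← threshold≤sum-take ℓ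
         (Linked⇒AllPairs (flip ≤-trans) (sort-↗ zs)) = begin
    List.sum ys
      ≤⟨ sum≤threshold θ ys ⟩
    length ys * θ + List.sum (map (_∸ θ) ys)
      ≤⟨ +-mono-≤ (*-monoˡ-≤ θ ys≤ℓ) (sum-⊆ (_∸ θ) ys⊆xs) ⟩
    ℓ * θ + List.sum (map (_∸ θ) xs)
      ≡⟨ cong (ℓ * θ +_) (sum-↭ (map⁺ (_∸ θ) (↭-trans xs↭zs (↭-sym (sort-↭ zs))))) ⟩
    ℓ * θ + List.sum (map (_∸ θ) (sort zs))
      ≤⟨ bound ⟩
    List.sum (take ℓ (sort zs)) ∎
  where
  open ≤-Reasoning

rowSum-take-≤ : ∀ ℓ (Cs : List (Column m)) i → rowSum (take ℓ Cs) i ≤ rowSum Cs i ⊓ ℓ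
rowSum-take-≤ zero    Cs       i = z≤n
rowSum-take-≤ (suc ℓ) []       i = z≤n
rowSum-take-≤ (suc ℓ) (C ∷ Cs) i with C i | rowSum-take-≤ ℓ Cs i
... | 0F | le = ≤-trans le (⊓-monoʳ-≤ (rowSum Cs i) (n≤1+n ℓ))
... | 1F | le = s≤s le

-- The easy half of Gale-Ryser: permute the columns themselves so that their sums appear sorted;
-- then `ℓ` columns contribute to each row at most `ℓ` and at most its row sum.
sum-take-sort-cols-≤ : ∀ ℓ (Cs : List (Column m)) →
  List.sum (take ℓ (sort (map colSum Cs))) ≤ sum (λ i → rowSum Cs i ⊓ ℓ)
sum-take-sort-cols-≤ ℓ Cs
  with Ds , eq , Cs↭Ds ← ↭-map-inv colSum (↭-sym (sort-↭ (map colSum Cs))) = begin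
    List.sum (take ℓ (sort (map colSum Cs))) ≡⟨ cong (List.sum ∘ take ℓ) eq ⟩
    List.sum (take ℓ (map colSum Ds))        ≡⟨ cong List.sum (take-map ℓ Ds) ⟩
    List.sum (map colSum (take ℓ Ds))        ≡⟨ double-count (take ℓ Ds) ⟩
    sum (rowSum (take ℓ Ds))                 ≤⟨ sum-mono-≤ (rowSum-take-≤ ℓ Ds) ⟩
    sum (λ i → rowSum Ds i ⊓ ℓ)
      ≡⟨ sum-cong-≗ (λ i → cong (_⊓ ℓ) (sum-↭ (map⁺ (λ C → toℕ (C i)) Cs↭Ds))) ⟨
    sum (λ i → rowSum Cs i ⊓ ℓ)              ∎
  where open ≤-Reasoning

length-filter-toList : ∀ {m a p} {A : Set a} {P : Pred A p} (P? : Decidable P) (v : Vector A m) →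
  length (filter P? (toList v)) ≡ colSum (bit ∘ P? ∘ v)
length-filter-toList {zero}  P? v = refl
length-filter-toList {suc m} P? v with P? (v zero)
... | yes _ = cong suc (length-filter-toList P? (v ∘ suc))
... | no  _ = length-filter-toList P? (v ∘ suc)

-- The left-justified matrix with rows `r`. Its column sums form the conjugate, so `double-count`
-- turns partial sums of the conjugate into sums over rows.
ferrers : Vector ℕ m → ℕ → List (Column m)
ferrers r = applyUpTo (λ k i → bit (suc k ≤? r i))

rowSum-ferrers : (r : Vector ℕ m) → ∀ N i → rowSum (ferrers r N) i ≡ N ⊓ r i
rowSum-ferrers r N i = trans (cong List.sum (map-applyUpTo _ _ N)) (staircase N (r i))
  where
  staircase : ∀ N y → List.sum (applyUpTo (λ k → toℕ (bit (suc k ≤? y))) N) ≡ N ⊓ y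
  staircase zero    y       = refl
  staircase (suc N) zero    = trans (staircase N zero) (⊓-zeroʳ N)
  staircase (suc N) (suc y) = cong suc (staircase N y)

take-applyUpTo : ∀ {a} {A : Set a} (f : ℕ → A) ℓ N →
  take ℓ (applyUpTo f N) ≡ applyUpTo f (ℓ ⊓ N)
take-applyUpTo f zero    N       = refl
take-applyUpTo f (suc ℓ) zero    = refl
take-applyUpTo f (suc ℓ) (suc N) = cong (f 0 ∷_) (take-applyUpTo (f ∘ suc) ℓ N)

module _ (r : Vector ℕ m) where

  private
    N : ℕ
    N = max 0 (toList r)

    r≤N : ∀ i → r i ≤ N
    r≤N = tabulate⁻ (xs≤max 0 (toList r))

  conjugate-ferrers : conjugate (toList r) ≡ map colSum (ferrers r N)
  conjugate-ferrers = trans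
    (applyUpTo-cong (λ k → length-filter-toList (suc k ≤?_) r) N)
    (sym (map-applyUpTo _ colSum N))
    where
    applyUpTo-cong : ∀ {a} {A : Set a} {f g : ℕ → A} → f ≗ g → applyUpTo f ≗ applyUpTo g
    applyUpTo-cong f≗g zero    = refl
    applyUpTo-cong f≗g (suc n) = cong₂ _∷_ (f≗g 0) (applyUpTo-cong (f≗g ∘ suc) n)

  sum-conjugate : List.sum (conjugate (toList r)) ≡ sum r
  sum-conjugate = begin
    List.sum (conjugate (toList r))        ≡⟨ cong List.sum conjugate-ferrers ⟩
    List.sum (map colSum (ferrers r N))    ≡⟨ double-count (ferrers r N) ⟩
    sum (rowSum (ferrers r N))             ≡⟨ sum-cong-≗ (rowSum-ferrers r N) ⟩
    sum (λ i → N ⊓ r i)                    ≡⟨ sum-cong-≗ (λ i → m≥n⇒m⊓n≡n (r≤N i)) ⟩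
    sum r                                  ∎
    where open ≡-Reasoning

  sum-take-conjugate : ∀ ℓ → List.sum (take ℓ (conjugate (toList r))) ≡ sum (λ i → r i ⊓ ℓ)
  sum-take-conjugate ℓ = begin
    List.sum (take ℓ (conjugate (toList r)))     ≡⟨ cong (List.sum ∘ take ℓ) conjugate-ferrers ⟩
    List.sum (take ℓ (map colSum (ferrers r N))) ≡⟨ cong List.sum (take-map ℓ (ferrers r N)) ⟩
    List.sum (map colSum (take ℓ (ferrers r N)))
      ≡⟨ cong (List.sum ∘ map colSum) (take-applyUpTo _ ℓ N) ⟩
    List.sum (map colSum (ferrers r (ℓ ⊓ N)))    ≡⟨ double-count (ferrers r (ℓ ⊓ N)) ⟩
    sum (rowSum (ferrers r (ℓ ⊓ N)))             ≡⟨ sum-cong-≗ (rowSum-ferrers r (ℓ ⊓ N)) ⟩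
    sum (λ i → ℓ ⊓ N ⊓ r i)                      ≡⟨ sum-cong-≗ (λ i → begin
        ℓ ⊓ N ⊓ r i   ≡⟨ ⊓-assoc ℓ N (r i) ⟩
        ℓ ⊓ (N ⊓ r i) ≡⟨ cong (ℓ ⊓_) (m≥n⇒m⊓n≡n (r≤N i)) ⟩
        ℓ ⊓ r i       ≡⟨ ⊓-comm ℓ (r i) ⟩
        r i ⊓ ℓ       ∎) ⟩
    sum (λ i → r i ⊓ ℓ) ∎
    where open ≡-Reasoning

  -- Two bounds take the place of a proof that the conjugate is already sorted: the easy half of
  -- Gale-Ryser for the Ferrers matrix from above, and the unsorted prefix as one choice of `ℓ`
  -- entries from below.
  sum-take-sort-conjugate : ∀ ℓ →
    List.sum (take ℓ (sort (conjugate (toList r)))) ≡ sum (λ i → r i ⊓ ℓ)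
  sum-take-sort-conjugate ℓ = ≤-antisym upper lower
    where
    open ≤-Reasoning
    upper : List.sum (take ℓ (sort (conjugate (toList r)))) ≤ sum (λ i → r i ⊓ ℓ)
    upper = begin
      List.sum (take ℓ (sort (conjugate (toList r))))
        ≡⟨ cong (List.sum ∘ take ℓ ∘ sort) conjugate-ferrers ⟩
      List.sum (take ℓ (sort (map colSum (ferrers r N))))
        ≤⟨ sum-take-sort-cols-≤ ℓ (ferrers r N) ⟩
      sum (λ i → rowSum (ferrers r N) i ⊓ ℓ)
        ≡⟨ sum-cong-≗ (λ i → cong (_⊓ ℓ) (trans (rowSum-ferrers r N i) (m≥n⇒m⊓n≡n (r≤N i)))) ⟩
      sum (λ i → r i ⊓ ℓ) ∎
    lower : sum (λ i → r i ⊓ ℓ) ≤ List.sum (take ℓ (sort (conjugate (toList r))))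
    lower = begin
      sum (λ i → r i ⊓ ℓ) ≡⟨ sum-take-conjugate ℓ ⟨
      List.sum (take ℓ (conjugate (toList r)))
        ≤⟨ sum≤sum-take-sort ℓ (take-⊆ ℓ _) ↭-refl
             (≤-trans (≤-reflexive (length-take ℓ (conjugate (toList r)))) (m⊓n≤m ℓ _)) ⟩
      List.sum (take ℓ (sort (conjugate (toList r)))) ∎

-- Symmetric vectors

2∣2+n⇒2∣n : 2 ∣ 2 + n → 2 ∣ n
2∣2+n⇒2∣n 2∣2+n = ∣m+n∣m⇒∣n 2∣2+n ∣-refl

2∣n⇒2∣2+n : 2 ∣ n → 2 ∣ 2 + n
2∣n⇒2∣2+n = ∣m∣n⇒∣m+n ∣-refl

2∤1 : ¬ 2 ∣ 1
2∤1 2∣1 with () ← ∣1⇒≡1 2∣1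

Symmetric : Vector X n → Set
Symmetric v = ∀ j → v j ≡ v (opposite j)

inner : Vector X (2 + n) → Vector X n
inner v j = v (suc (inject₁ j))

-- Both ends are peeled off at once, so the recursion preserves the parity of `n` and lists the
-- entries from the outside inwards.
half : Vector X n → List X
half {n = 0}           v = []
half {n = 1}           v = []
half {n = suc (suc n)} v = v zero ∷ half (inner v)

-- A list, so that even lengths, where it is empty, and odd lengths share their statements.
centre : Vector X n → List X
centre {n = 0}           v = []
centre {n = 1}           v = [ v zero ]
centre {n = suc (suc n)} v = centre (inner v)

opposite-inner : (j : Fin n) → opposite (suc (inject₁ j)) ≡ suc (inject₁ (opposite j))
opposite-inner j = cong inject₁ (opposite-inject₁ j)
  where
  opposite-inject₁ : ∀ {n} (j : Fin n) → opposite (inject₁ j) ≡ suc (opposite j)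
  opposite-inject₁ zero    = refl
  opposite-inject₁ (suc j) = cong inject₁ (opposite-inject₁ j)

inner-symmetric : {v : Vector X (2 + n)} → Symmetric v → Symmetric (inner v)
inner-symmetric {v = v} sym-v j = trans (sym-v (suc (inject₁ j))) (cong v (opposite-inner j))

toList-∷ʳ : (v : Vector X (suc n)) → toList v ≡ toList (v ∘ inject₁) ++ [ v (fromℕ n) ]
toList-∷ʳ {n = zero}  v = refl
toList-∷ʳ {n = suc n} v = cong (v zero ∷_) (toList-∷ʳ (v ∘ suc))

toList-symmetric : {v : Vector X n} → Symmetric v → toList v ↭ centre v ++ half v ++ half v
toList-symmetric {n = 0}                   sym-v = ↭-refl
toList-symmetric {n = 1}                   sym-v = ↭-refl
toList-symmetric {n = suc (suc n)} {v = v} sym-v = begin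
  v zero ∷ toList (v ∘ suc)
    ≡⟨ cong (v zero ∷_) (toList-∷ʳ (v ∘ suc)) ⟩
  v zero ∷ toList (inner v) ++ [ v (fromℕ (suc n)) ]
    ≡⟨ cong (λ x → v zero ∷ toList (inner v) ++ [ x ]) (sym-v zero) ⟨
  v zero ∷ toList (inner v) ++ [ v zero ]
    ↭⟨ prep _ (∷↭∷ʳ (v zero) (toList (inner v))) ⟨
  v zero ∷ v zero ∷ toList (inner v)
    ↭⟨ prep _ (prep _ (toList-symmetric (inner-symmetric sym-v))) ⟩
  -- The two equal end entries move past the centre, one to the front of each half.
  v zero ∷ v zero ∷ c ++ h ++ h
    ↭⟨ prep _ (shift _ c (h ++ h)) ⟨
  v zero ∷ c ++ v zero ∷ h ++ h
    ↭⟨ shift _ c _ ⟨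
  c ++ v zero ∷ v zero ∷ h ++ h
    ↭⟨ ++⁺ˡ c (prep _ (shift _ h h)) ⟨
  c ++ v zero ∷ h ++ v zero ∷ h ∎
  where
  open PermutationReasoning
  c = centre (inner v)
  h = half (inner v)

middle-inner : ∀ k → middle (3 + k) ≡ suc (inject₁ (middle (suc k)))
middle-inner k = cong suc (toℕ-injective (begin
  toℕ (fromℕ< (s≤s (⌊n/2⌋≤1+n k)))     ≡⟨ toℕ-fromℕ< _ ⟩
  ⌊ k /2⌋                              ≡⟨ toℕ-fromℕ< (s≤s (⌊n/2⌋≤n k)) ⟨
  toℕ (middle (suc k))                 ≡⟨ toℕ-inject₁ (middle (suc k)) ⟨
  toℕ (inject₁ (middle (suc k))) ∎))
  where
  open ≡-Reasoning
  ⌊n/2⌋≤1+n : ∀ k → ⌊ k /2⌋ ≤ suc k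
  ⌊n/2⌋≤1+n k = m≤n⇒m≤1+n (⌊n/2⌋≤n k)

centre-even : (v : Vector X n) → 2 ∣ n → centre v ≡ []
centre-even {n = 0}           v 2∣n = refl
centre-even {n = 1}           v 2∣n = contradiction 2∣n 2∤1
centre-even {n = suc (suc n)} v 2∣n = centre-even (inner v) (2∣2+n⇒2∣n 2∣n)

centre-odd : .{{_ : NonZero n}} (v : Vector X n) → ¬ 2 ∣ n → centre v ≡ [ v (middle n) ]
centre-odd {n = 1}                 v 2∤n = refl
centre-odd {n = 2}                 v 2∤n = contradiction ∣-refl 2∤n
centre-odd {n = suc (suc (suc k))} v 2∤n =
  trans (centre-odd (inner v) (2∤n ∘ 2∣n⇒2∣2+n)) (cong (λ j → [ v j ]) (sym (middle-inner k)))

-- `dropMiddleIfOdd` for entries of any type, so that it also applies to columns, and with the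
-- parity decision as an argument that proofs can match on.
offCentre : Dec (2 ∣ suc n) → Vector X (suc n) → List X
offCentre {n = n} even? v =
  if does even? then toList v else toList (removeAt v (middle (suc n)))

toList-removeAt : (v : Vector X (suc n)) (i : Fin (suc n)) → toList v ↭ v i ∷ toList (removeAt v i)
toList-removeAt             v zero    = ↭-refl
toList-removeAt {n = suc n} v (suc i) =
  ↭-trans (prep _ (toList-removeAt (v ∘ suc) i)) (swap _ _ ↭-refl)

toList-centre : ∀ even? (v : Vector X (suc n)) → toList v ↭ centre v ++ offCentre even? v
toList-centre (yes 2∣n) v rewrite centre-even v 2∣n = ↭-refl
toList-centre (no  2∤n) v rewrite centre-odd v 2∤n  = toList-removeAt v (middle _)

-- Both sides complete `centre v` to the whole list, so the centre cancels.
offCentre-symmetric : ∀ even? {v : Vector X (suc n)} → Symmetric v →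
  offCentre even? v ↭ half v ++ half v
offCentre-symmetric even? {v} sym-v =
  dropCentre even? (↭-trans (↭-sym (toList-centre even? v)) (toList-symmetric sym-v))
  where
  dropCentre : ∀ {xs ys} → Dec _ → centre v ++ xs ↭ centre v ++ ys → xs ↭ ys
  dropCentre (yes 2∣n) p rewrite centre-even v 2∣n = p
  dropCentre (no  2∤n) p rewrite centre-odd v 2∤n  = drop-∷ p

map-offCentre : ∀ even? (f : X → Y) (v : Vector X (suc n)) →
  map f (offCentre even? v) ≡ offCentre even? (f ∘ v)
map-offCentre (yes _) f v = map-tabulate v f
map-offCentre (no  _) f v = map-tabulate (removeAt v (middle _)) f

offCentre-cong : ∀ even? {v w : Vector X (suc n)} → v ≗ w → offCentre even? v ≡ offCentre even? w
offCentre-cong (yes _) v≗w = tabulate-cong v≗w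
offCentre-cong (no  _) v≗w = tabulate-cong (λ j → v≗w _)

map-half : (f : X → Y) (v : Vector X n) → map f (half v) ≡ half (f ∘ v)
map-half {n = 0}           f v = refl
map-half {n = 1}           f v = refl
map-half {n = suc (suc n)} f v = cong (f (v zero) ∷_) (map-half f (inner v))

-- The distance to the nearer end, which is also the position in `half` of the entry at `j` or its
-- mirror image.
depth : Fin n → ℕ
depth j = toℕ j ⊓ toℕ (opposite j)

depth-opposite : (j : Fin n) → depth j ≡ depth (opposite j)
depth-opposite j =
  trans (⊓-comm (toℕ j) _) (cong ((toℕ (opposite j) ⊓_) ∘ toℕ) (sym (opposite-involutive j)))

depth-inner : (j : Fin n) → depth (suc (inject₁ j)) ≡ suc (depth j)
depth-inner j = cong₂ _⊓_ (cong suc (toℕ-inject₁ j))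
  (trans (cong toℕ (opposite-inner j)) (cong suc (toℕ-inject₁ (opposite j))))

lookupOr : X → List X → ℕ → X
lookupOr d []       _       = d
lookupOr d (x ∷ xs) zero    = x
lookupOr d (x ∷ xs) (suc k) = lookupOr d xs k

map-lookupOr : (f : X → Y) (d : X) → ∀ xs k → f (lookupOr d xs k) ≡ lookupOr (f d) (map f xs) k
map-lookupOr f d []       k       = refl
map-lookupOr f d (x ∷ xs) zero    = refl
map-lookupOr f d (x ∷ xs) (suc k) = map-lookupOr f d xs k

-- The list runs out exactly at the middle position, which then gets d.
unfold : X → List X → Vector X n
unfold d xs j = lookupOr d xs (depth j)

unfold-symmetric : (d : X) (xs : List X) → Symmetric {n = n} (unfold d xs)
unfold-symmetric d xs j = cong (lookupOr d xs) (depth-opposite j)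

-- `half` forgets the middle entry, so the default has to restore it; stating this through `centre`
-- covers both parities.
unfold-half : {v : Vector X n} → Symmetric v → ∀ d → (∀ {x} → centre v ≡ [ x ] → x ≡ d) →
  unfold d (half v) ≗ v
unfold-half {n = 1} sym-v d c zero = sym (c refl)
unfold-half {n = suc (suc n)} {v} sym-v d c zero = refl
unfold-half {n = suc (suc n)} {v} sym-v d c (suc j) with view j
-- The last position mirrors position zero on both sides.
... | ‵fromℕ = trans (sym (unfold-symmetric {n = suc (suc n)} d (half v) zero)) (sym-v zero)
... | ‵inject₁ i = trans (cong (lookupOr d (half v)) (depth-inner i))
                         (unfold-half (inner-symmetric sym-v) d c i)

half-unfold : (d : X) (xs : List X) → length xs ≡ ⌊ n /2⌋ → half (unfold {n = n} d xs) ≡ xs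
half-unfold {n = 0}           d []       eq = refl
half-unfold {n = 1}           d []       eq = refl
half-unfold {n = suc (suc n)} d (x ∷ xs) eq = cong (x ∷_) (trans
  (half-cong (λ j → cong (lookupOr d (x ∷ xs)) (depth-inner j)))
  (half-unfold d xs (suc-injective eq)))
  where
  half-cong : ∀ {n} {v w : Vector X n} → v ≗ w → half v ≡ half w
  half-cong {n = 0}           v≗w = refl
  half-cong {n = 1}           v≗w = refl
  half-cong {n = suc (suc n)} v≗w = cong₂ _∷_ (v≗w zero) (half-cong (v≗w ∘ suc ∘ inject₁))

length-half : (v : Vector X n) → length (half v) ≡ ⌊ n /2⌋
length-half {n = 0}           v = refl
length-half {n = 1}           v = refl
length-half {n = suc (suc n)} v = cong suc (length-half (inner v))

unfold-middle : .{{_ : NonZero n}} (d : X) (xs : List X) → length xs ≡ ⌊ n /2⌋ → ¬ 2 ∣ n →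
  unfold d xs (middle n) ≡ d
unfold-middle {n = 1}                 d []       eq 2∤n = refl
unfold-middle {n = 2}                 d xs       eq 2∤n = contradiction ∣-refl 2∤n
unfold-middle {n = suc (suc (suc k))} d (x ∷ xs) eq 2∤n = trans
  (cong (lookupOr d (x ∷ xs)) (trans (cong depth (middle-inner k)) (depth-inner (middle (suc k)))))
  (unfold-middle d xs (suc-injective eq) (2∤n ∘ 2∣n⇒2∣2+n))

-- Parity of the rows and the two implications

roundDown : ℕ → ℕ
roundDown r = if does (2 ∣? r) then r else pred r

oddBit : ℕ → Fin 2
oddBit r = bit (¬? (2 ∣? r))

oddBit-even : ∀ {r} → 2 ∣ r → oddBit r ≡ 0F
oddBit-even {r} 2∣r = bit-no (¬? (2 ∣? r)) (λ 2∤r → 2∤r 2∣r)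

oddBit≡0⇒even : ∀ r → oddBit r ≡ 0F → 2 ∣ r
oddBit≡0⇒even r eq = decidable-stable (2 ∣? r) (bit≡0⇒¬ (¬? (2 ∣? r)) eq)

2∣n+n : ∀ n → 2 ∣ n + n
2∣n+n n = divides n (trans (cong (n +_) (sym (+-identityʳ n))) (*-comm 2 n))

double? : ∀ n → ∃ λ h → n ≡ h + h ⊎ n ≡ suc (h + h)
double? zero    = 0 , inj₁ refl
double? (suc n) with double? n
... | h , inj₁ refl = h , inj₂ refl
... | h , inj₂ refl = suc h , inj₁ (cong suc (sym (+-suc h h)))

2∤1+h+h : ∀ h → ¬ 2 ∣ suc (h + h)
2∤1+h+h h 2∣1+2h = 2∤1 (∣m+n∣m⇒∣n (subst (2 ∣_) (+-comm 1 (h + h)) 2∣1+2h) (2∣n+n h))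

-- A decomposition into a bit and a double is unique, so any such decomposition of a row sum reveals
-- its parity and its rounded value.
oddBit-roundDown : ∀ (b : Fin 2) h →
  oddBit (toℕ b + (h + h)) ≡ b × roundDown (toℕ b + (h + h)) ≡ h + h
oddBit-roundDown 0F h =
  oddBit-even (2∣n+n h) ,
  cong (if_then h + h else pred (h + h)) (dec-true (2 ∣? (h + h)) (2∣n+n h))
oddBit-roundDown 1F h =
  bit-yes (¬? (2 ∣? suc (h + h))) (2∤1+h+h h) ,
  cong (if_then suc (h + h) else h + h) (dec-false (2 ∣? suc (h + h)) (2∤1+h+h h))

halve : ∀ r → ∃ λ h → roundDown r ≡ h + h × toℕ (oddBit r) + (h + h) ≡ r
halve r with double? r
... | h , inj₁ refl = let odd , down = oddBit-roundDown 0F h in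
  h , down , cong (λ b → toℕ b + (h + h)) odd
... | h , inj₂ refl = let odd , down = oddBit-roundDown 1F h in
  h , down , cong (λ b → toℕ b + (h + h)) odd

countOdd-sum : (R : Vector ℕ m) → countOdd R ≡ sum (toℕ ∘ oddBit ∘ R)
countOdd-sum R = length-filter-toList (λ r → ¬? (2 ∣? r)) R

roundDownEven-toList : (R : Vector ℕ m) → roundDownEven R ≡ toList (roundDown ∘ R)
roundDownEven-toList R = map-tabulate R roundDown

sum-toList : (v : Vector ℕ n) → List.sum (toList v) ≡ sum v
sum-toList {zero}  v = refl
sum-toList {suc n} v = cong (v zero +_) (sum-toList (v ∘ suc))

sum-doubled : ∀ xs → List.sum (xs ++ xs) ≡ List.sum xs + List.sum xs
sum-doubled xs = sum-++ xs xs

sum-symmetric : {v : Vector ℕ n} → Symmetric v →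
  sum v ≡ List.sum (centre v) + (List.sum (half v) + List.sum (half v))
sum-symmetric {v = v} sym-v = begin
  sum v                                       ≡⟨ sum-toList v ⟨
  List.sum (toList v)                         ≡⟨ sum-↭ (toList-symmetric sym-v) ⟩
  List.sum (centre v ++ half v ++ half v)     ≡⟨ sum-++ (centre v) _ ⟩
  List.sum (centre v) + List.sum (half v ++ half v)
    ≡⟨ cong (List.sum (centre v) +_) (sum-doubled (half v)) ⟩
  List.sum (centre v) + (List.sum (half v) + List.sum (half v)) ∎
  where open ≡-Reasoning

centreBit : Dec (2 ∣ suc n) → Vector (Fin 2) (suc n) → Fin 2
centreBit even? w = if does even? then 0F else w (middle _)

sum-centre : ∀ even? (w : Vector (Fin 2) (suc n)) →
  List.sum (centre (toℕ ∘ w)) ≡ toℕ (centreBit even? w)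
sum-centre (yes 2∣n) w rewrite centre-even (toℕ ∘ w) 2∣n = refl
sum-centre (no  2∤n) w rewrite centre-odd (toℕ ∘ w) 2∤n  = +-identityʳ _

-- Mirror pairs contribute twice the sum of the half, so the centre alone decides the parity.
symmetric-row : ∀ even? {w : Vector (Fin 2) (suc n)} → Symmetric w →
  oddBit (sum (toℕ ∘ w)) ≡ centreBit even? w ×
  roundDown (sum (toℕ ∘ w)) ≡ List.sum (offCentre even? (toℕ ∘ w))
symmetric-row even? {w} sym-w =
  let h = List.sum (half (toℕ ∘ w))
      odd , down = oddBit-roundDown (centreBit even? w) h
      eq : sum (toℕ ∘ w) ≡ toℕ (centreBit even? w) + (h + h)
      eq = trans (sum-symmetric (cong toℕ ∘ sym-w)) (cong (_+ (h + h)) (sum-centre even? w))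
      off = trans (sum-↭ (offCentre-symmetric even? (cong toℕ ∘ sym-w)))
                  (sum-doubled (half (toℕ ∘ w)))
  in trans (cong oddBit eq) odd , trans (cong roundDown eq) (trans down (sym off))

module Necessity {m k} (even? : Dec (2 ∣ suc k)) (R : Vector ℕ m) (S : Vector ℕ (suc k))
  {A : Matrix01 m (suc k)} (A∈𝒜 : 𝒜∞ R S A) where

  open 𝒜∞ A∈𝒜

  row-facts : ∀ i → oddBit (R i) ≡ centreBit even? (A i) ×
    roundDown (R i) ≡ List.sum (offCentre even? (toℕ ∘ A i))
  row-facts i = subst (λ r → oddBit r ≡ centreBit even? (A i) ×
    roundDown r ≡ List.sum (offCentre even? (toℕ ∘ A i)))
    (rowSums i) (symmetric-row even? (invariant i))

  palindromic : Palindromic S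
  palindromic j = begin
    S j                            ≡⟨ colSums j ⟨
    sum (λ i → toℕ (A i j))        ≡⟨ sum-cong-≗ (λ i → cong toℕ (invariant i j)) ⟩
    sum (λ i → toℕ (A i (opposite j))) ≡⟨ colSums (opposite j) ⟩
    S (opposite j)                 ∎
    where open ≡-Reasoning

  parity : ParityCondition R S
  parity = rows-even even? (proj₁ ∘ row-facts) , middle-odd even? (proj₁ ∘ row-facts)
    where
    -- The decision is quantified afresh so that matching on it reduces `centreBit`.
    rows-even : ∀ even? → (∀ i → oddBit (R i) ≡ centreBit even? (A i)) → 2 ∣ suc k → ∀ i → 2 ∣ R i
    rows-even (yes _)  odd _   i = oddBit≡0⇒even (R i) (odd i)
    rows-even (no 2∤n) odd 2∣n i = contradiction 2∣n 2∤n
    middle-odd : ∀ even? → (∀ i → oddBit (R i) ≡ centreBit even? (A i)) →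
      ¬ 2 ∣ suc k → countOdd R ≤ S (middle (suc k))
    middle-odd (yes 2∣n) odd 2∤n = contradiction 2∣n 2∤n
    -- The inequality is in fact an equality: the middle column is the parity vector of `R`.
    middle-odd (no _)    odd _   = ≤-reflexive (begin
      countOdd R                                ≡⟨ countOdd-sum R ⟩
      sum (toℕ ∘ oddBit ∘ R)                    ≡⟨ sum-cong-≗ (cong toℕ ∘ odd) ⟩
      sum (λ i → toℕ (A i (middle (suc k))))    ≡⟨ colSums (middle (suc k)) ⟩
      S (middle (suc k))                        ∎)
      where open ≡-Reasoning

  private
    columns : List (Column m)
    columns = offCentre even? (flip A)

    columns-colSums : map colSum columns ≡ offCentre even? S
    columns-colSums = trans (map-offCentre even? colSum (flip A)) (offCentre-cong even? colSums)

    columns-rowSums : rowSum columns ≗ roundDown ∘ R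
    columns-rowSums i = trans
      (cong List.sum (map-offCentre even? (λ C → toℕ (C i)) (flip A)))
      (sym (proj₂ (row-facts i)))

  -- The easy half of Gale-Ryser for the off-centre columns, whose row sums are the rounded-down
  -- ones.
  majorized : offCentre even? S ⪯ conjugate (toList (roundDown ∘ R))
  majorized = prefix , total
    where
    total : List.sum (conjugate (toList (roundDown ∘ R))) ≡ List.sum (offCentre even? S)
    total = begin
      List.sum (conjugate (toList (roundDown ∘ R)))   ≡⟨ sum-conjugate (roundDown ∘ R) ⟩
      sum (roundDown ∘ R)                   ≡⟨ sum-cong-≗ columns-rowSums ⟨
      sum (rowSum columns)                  ≡⟨ double-count columns ⟨
      List.sum (map colSum columns)         ≡⟨ cong List.sum columns-colSums ⟩
      List.sum (offCentre even? S)          ∎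
      where open ≡-Reasoning
    prefix : ∀ ℓ → List.sum (take ℓ (sort (offCentre even? S))) ≤
      List.sum (take ℓ (sort (conjugate (toList (roundDown ∘ R)))))
    prefix ℓ = begin
      List.sum (take ℓ (sort (offCentre even? S)))
        ≡⟨ cong (List.sum ∘ take ℓ ∘ sort) columns-colSums ⟨
      List.sum (take ℓ (sort (map colSum columns)))
        ≤⟨ sum-take-sort-cols-≤ ℓ columns ⟩
      sum (λ i → rowSum columns i ⊓ ℓ)
        ≡⟨ sum-cong-≗ (λ i → cong (_⊓ ℓ) (columns-rowSums i)) ⟩
      sum (λ i → roundDown (R i) ⊓ ℓ)
        ≡⟨ sum-take-sort-conjugate (roundDown ∘ R) ℓ ⟨
      List.sum (take ℓ (sort (conjugate (toList (roundDown ∘ R))))) ∎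
      where open ≤-Reasoning

+-cancel-halves-≤ : ∀ {a b} → a + a ≤ b + b → a ≤ b
+-cancel-halves-≤ {a} {b} 2a≤2b with a ≤? b
... | yes a≤b = a≤b
... | no  a≰b = contradiction 2a≤2b (<⇒≱ (+-mono-< (≰⇒> a≰b) (≰⇒> a≰b)))

+-cancel-halves-≡ : ∀ {a b} → a + a ≡ b + b → a ≡ b
+-cancel-halves-≡ eq =
  ≤-antisym (+-cancel-halves-≤ (≤-reflexive eq)) (+-cancel-halves-≤ (≤-reflexive (sym eq)))

⊓-double : ∀ a b → (a + a) ⊓ (b + b) ≡ (a ⊓ b) + (a ⊓ b)
⊓-double zero    b       = refl
⊓-double (suc a) zero    = refl
⊓-double (suc a) (suc b) rewrite +-suc a a | +-suc b b | +-suc (a ⊓ b) (a ⊓ b) =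
  cong (2 +_) (⊓-double a b)

module Sufficiency {m k} (even? : Dec (2 ∣ suc k)) (R : Vector ℕ m) (S : Vector ℕ (suc k))
  (sum-eq : sum R ≡ sum S) (S-sym : Palindromic S) (parity : ParityCondition R S)
  (maj : offCentre even? S ⪯ conjugate (toList (roundDown ∘ R))) where

  private
    h : Vector ℕ m
    h i = proj₁ (halve (R i))

    h+h : ∀ i → roundDown (R i) ≡ h i + h i
    h+h i = proj₁ (proj₂ (halve (R i)))

    odd : Column m
    odd = oddBit ∘ R

    odd+h+h : ∀ i → toℕ (odd i) + (h i + h i) ≡ R i
    odd+h+h i = proj₂ (proj₂ (halve (R i)))

    sum-half : List.sum (half S) ≡ sum h
    sum-half = +-cancel-halves-≡ (begin
      List.sum (half S) + List.sum (half S)        ≡⟨ sum-doubled (half S) ⟨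
      List.sum (half S ++ half S)                  ≡⟨ sum-↭ (offCentre-symmetric even? S-sym) ⟨
      List.sum (offCentre even? S)                 ≡⟨ proj₂ maj ⟨
      List.sum (conjugate (toList (roundDown ∘ R))) ≡⟨ sum-conjugate (roundDown ∘ R) ⟩
      sum (roundDown ∘ R)                          ≡⟨ sum-cong-≗ h+h ⟩
      sum (λ i → h i + h i)                        ≡⟨ ∑-distrib-+ h h ⟩
      sum h + sum h                                ∎)
      where open ≡-Reasoning

    -- A sublist of `half S` occurs twice in the off-centre part of `S`. Majorization at twice its
    -- length therefore gives twice the desired inequality.
    half-dominated : Dominated h (half S)
    half-dominated {ds} ds⊆ = +-cancel-halves-≤ (begin
      List.sum ds + List.sum ds   ≡⟨ sum-doubled ds ⟨
      List.sum (ds ++ ds)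
        ≤⟨ sum≤sum-take-sort (ℓ + ℓ) (++⁺ ds⊆ ds⊆) (↭-sym (offCentre-symmetric even? S-sym))
             (≤-reflexive (length-++ ds)) ⟩
      List.sum (take (ℓ + ℓ) (sort (offCentre even? S)))
        ≤⟨ proj₁ maj (ℓ + ℓ) ⟩
      List.sum (take (ℓ + ℓ) (sort (conjugate (toList (roundDown ∘ R)))))
        ≡⟨ sum-take-sort-conjugate (roundDown ∘ R) (ℓ + ℓ) ⟩
      sum (λ i → roundDown (R i) ⊓ (ℓ + ℓ))
        ≡⟨ sum-cong-≗ (λ i → trans (cong (_⊓ (ℓ + ℓ)) (h+h i)) (⊓-double (h i) ℓ)) ⟩
      sum (λ i → (h i ⊓ ℓ) + (h i ⊓ ℓ))
        ≡⟨ ∑-distrib-+ (λ i → h i ⊓ ℓ) (λ i → h i ⊓ ℓ) ⟩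
      sum (λ i → h i ⊓ ℓ) + sum (λ i → h i ⊓ ℓ) ∎)
      where
      open ≤-Reasoning
      ℓ = length ds

    -- Comparing the two total sums forces equality in s_⌈n/2⌉ ≥ o(R).
    sum-odd : colSum odd ≡ List.sum (centre S)
    sum-odd = +-cancelʳ-≡ (sum h + sum h) _ _ (begin
      colSum odd + (sum h + sum h)               ≡⟨ cong (colSum odd +_) (∑-distrib-+ h h) ⟨
      colSum odd + sum (λ i → h i + h i)         ≡⟨ ∑-distrib-+ (toℕ ∘ odd) (λ i → h i + h i) ⟨
      sum (λ i → toℕ (odd i) + (h i + h i))      ≡⟨ sum-cong-≗ odd+h+h ⟩
      sum R                                      ≡⟨ sum-eq ⟩
      sum S                                      ≡⟨ sum-symmetric S-sym ⟩
      List.sum (centre S) + (List.sum (half S) + List.sum (half S))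
        ≡⟨ cong (λ s → List.sum (centre S) + (s + s)) sum-half ⟩
      List.sum (centre S) + (sum h + sum h)      ∎)
      where open ≡-Reasoning

    centre-colSum : ∀ {s} → centre S ≡ [ s ] → s ≡ colSum odd
    centre-colSum {s} eq = sym (trans sum-odd (trans (cong List.sum eq) (+-identityʳ s)))

    left : ∃ λ Cs → map colSum Cs ≡ half S × ∀ i → rowSum Cs i ≡ h i
    left = gale-ryser (half S) h half-dominated sum-half

    Cs : List (Column m)
    Cs = proj₁ left

    -- The Gale-Ryser columns are mirrored around the middle. The parity column is the default, so
    -- it lands exactly in the middle for odd `n` and nowhere for even `n`.
    columns : Vector (Column m) (suc k)
    columns = unfold odd Cs

    length-Cs : length Cs ≡ ⌊ suc k /2⌋
    length-Cs = trans (sym (length-map colSum Cs))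
      (trans (cong length (proj₁ (proj₂ left))) (length-half S))

    half-columns : half columns ≡ Cs
    half-columns = half-unfold {n = suc k} odd Cs length-Cs

    half-row : ∀ i → List.sum (half (λ j → toℕ (columns j i))) ≡ h i
    half-row i = begin
      List.sum (half (λ j → toℕ (columns j i)))     ≡⟨ cong List.sum (map-half (λ C → toℕ (C i)) columns) ⟨
      rowSum (half columns) i                       ≡⟨ cong (λ Ds → rowSum Ds i) half-columns ⟩
      rowSum Cs i                                   ≡⟨ proj₂ (proj₂ left) i ⟩
      h i                                           ∎
      where open ≡-Reasoning

    centre-row : ∀ i → List.sum (centre (λ j → toℕ (columns j i))) ≡ toℕ (odd i)
    centre-row i = trans (sum-centre even? (λ j → columns j i)) (cong toℕ (centreBit≡odd even?))
      where
      centreBit≡odd : ∀ even? → centreBit even? (λ j → columns j i) ≡ odd i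
      -- Without a middle column, the parity vector must vanish, which is what condition (b) grants.
      centreBit≡odd (yes 2∣n) = sym (oddBit-even (proj₁ parity 2∣n i))
      centreBit≡odd (no  2∤n) = cong (λ C → C i) (unfold-middle odd Cs length-Cs 2∤n)

  matrix : Satisfiable (𝒜∞ R S)
  matrix = (λ i j → columns j i) , record
    { rowSums   = λ i → trans
                   (sum-symmetric {v = λ j → toℕ (columns j i)}
                     (λ j → cong (λ C → toℕ (C i)) (unfold-symmetric odd Cs j)))
                   (trans (cong₂ _+_ (centre-row i) (cong₂ _+_ (half-row i) (half-row i))) (odd+h+h i))
    -- Taking column sums commutes with unfolding, and unfolding `half S` around the sum of the
    -- parity column gives back `S`.
    ; colSums   = λ j → trans (map-lookupOr colSum odd Cs (depth j))
                   (trans (cong (λ ss → lookupOr (colSum odd) ss (depth j)) (proj₁ (proj₂ left)))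
                          (unfold-half S-sym (colSum odd) centre-colSum j))
    ; invariant = λ i j → cong (λ C → C i) (unfold-symmetric odd Cs j)
    }

theorem12 : ∀ (m n : ℕ) → .{{_ : NonZero m}} → .{{_ : NonZero n}} →
    (R : Vector ℕ m) (S : Vector ℕ n) →
    (∀ i → R i ≤ n) → (∀ j → S j ≤ m) → sum R ≡ sum S →
    Satisfiable (𝒜∞ R S) ⇔
    ( Palindromic S
    × ParityCondition R S
    × dropMiddleIfOdd S ⪯ conjugate (roundDownEven R) )
theorem12 m (suc k) R S _ _ sum-eq rewrite roundDownEven-toList R = mk⇔
  -- `dropMiddleIfOdd S` unfolds to `offCentre even? S`, the form used in both directions.
  (λ (A , A∈𝒜) → let open Necessity even? R S A∈𝒜 in palindromic , parity , majorized)
  (λ (S-sym , parity , maj) → Sufficiency.matrix even? R S sum-eq S-sym parity maj)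
  where even? = 2 ∣? suc k
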